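{- Let $n$ be a positive integer and let $\alpha,\beta,\gamma,\delta: \mathcal{P}(n) \to [0,\infty)$ satisfy \[ \alpha(A)\beta(B) \leq \gamma(A \cup B)\,\delta(A \cap B) \quad \text{for all } A,B \in \mathcal{P}(n). \] Then \[ \Big(\sum_{A \in \mathcal{P}(n)} \alpha(A)q^{|A|}\Big)\Big( \sum_{B \in \mathcal{P}(n)} \beta(B)q^{|B|}\Big) \ll \Big(\sum_{C \in \mathcal{P}(n)} \gamma(C)q^{|C|}\Big)\Big( \sum_{D \in \mathcal{P}(n)} \delta(D)q^{|D|}\Big). \] Equivalently, for every integer $k \ge 0$, \[ \sum_{|A|+|B|=k}\alpha(A)\beta(B) \le \sum_{|C|+|D|=k}\gamma(C)\delta(D), \] where the sums range over pairs of subsets of $[n]$.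
   Context: $[n]=\{1,\dots,n\}$ and $\mathcal{P}(n)$ denotes the power set of $[n]$. For real polynomials $P(q),R(q)$, $P(q) \ll R(q)$ means that every coefficient of $R(q)-P(q)$ is a non-negative real number. -}

module Defs where

open import Data.Fin.Subset using (Subset; inside; outside; ∣_∣)
open import Data.List.Base
  using (List; []; _∷_; _++_; map; foldr; filter; replicate; cartesianProduct)
open import Data.Nat.Base as ℕ using (ℕ; zero; suc)
import Data.Nat.Properties as ℕ
open import Data.Product.Base using (∃; _×_; _,_)
open import Data.Rational.Base as ℚ using (ℚ; 0ℚ; 1ℚ; ½)
import Data.Rational.Properties as ℚ
open import Data.Rational.Solver using (module +-*-Solver)
open import Data.Vec.Base using ([]; _∷_)
open import Relation.Binary.PropositionalEquality
  using (_≡_; refl; sym; trans; cong; cong₂; subst)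

open +-*-Solver using (solve; _:=_; _:+_; _:*_; _:-_; :-_)

-- The real numbers are Cauchy sequences of rationals.  They form a setoid: two
-- sequences represent the same real number when each is ≤ the other in the
-- order _≤ᴿ_ below.

IsCauchy : (ℕ → ℚ) → Set
IsCauchy s = ∀ ε → 0ℚ ℚ.< ε →
  ∃ λ N → ∀ m n → N ℕ.≤ m → N ℕ.≤ n → ℚ.∣ s m ℚ.- s n ∣ ℚ.< ε

record ℝ : Set where
  constructor mkℝ
  field
    seq      : ℕ → ℚ
    isCauchy : IsCauchy seq

open ℝ public

infix  4 _≤ᴿ_
infixl 6 _+ᴿ_
infixl 7 _*ᴿ_
infix  8 -ᴿ_

-- x ≤ y iff, for every ε > 0, eventually xₙ ≤ yₙ + ε; a termwise comparison
-- would not depend only on the limits.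
_≤ᴿ_ : ℝ → ℝ → Set
x ≤ᴿ y = ∀ ε → 0ℚ ℚ.< ε →
  ∃ λ N → ∀ n → N ℕ.≤ n → seq x n ℚ.≤ seq y n ℚ.+ ε

fromℚ : ℚ → ℝ
fromℚ p = mkℝ (λ _ → p) λ ε 0<ε →
  0 , λ _ _ _ _ → subst (ℚ._< ε) (sym (cong ℚ.∣_∣ (ℚ.+-inverseʳ p))) 0<ε

0ℝ : ℝ
0ℝ = fromℚ 0ℚ

private abstract
  halve : ∀ ε → 0ℚ ℚ.< ε → ∃ λ η → 0ℚ ℚ.< η × η ℚ.+ η ≡ ε
  halve ε 0<ε = ½ ℚ.* ε ,
    subst (ℚ._< ½ ℚ.* ε) (ℚ.*-zeroʳ ½) (ℚ.*-monoʳ-<-pos ½ 0<ε) ,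
    trans (sym (ℚ.*-distribʳ-+ ε ½ ½)) (ℚ.*-identityˡ ε)

  +-cauchy : ∀ {s t} → IsCauchy s → IsCauchy t → IsCauchy (λ n → s n ℚ.+ t n)
  +-cauchy {s} {t} cs ct ε 0<ε
    with halve ε 0<ε
  ... | η , 0<η , η+η≡ε with cs η 0<η | ct η 0<η
  ... | M , hs | N , ht = M ℕ.⊔ N , λ m n p q → begin-strict
    ℚ.∣ (s m ℚ.+ t m) ℚ.- (s n ℚ.+ t n) ∣
      ≡⟨ cong ℚ.∣_∣ (regroup (s m) (t m) (s n) (t n)) ⟩
    ℚ.∣ (s m ℚ.- s n) ℚ.+ (t m ℚ.- t n) ∣
      ≤⟨ ℚ.∣p+q∣≤∣p∣+∣q∣ (s m ℚ.- s n) (t m ℚ.- t n) ⟩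
    ℚ.∣ s m ℚ.- s n ∣ ℚ.+ ℚ.∣ t m ℚ.- t n ∣
      <⟨ ℚ.+-mono-< (hs m n (ℕ.m⊔n≤o⇒m≤o M N p) (ℕ.m⊔n≤o⇒m≤o M N q))
                    (ht m n (ℕ.m⊔n≤o⇒n≤o M N p) (ℕ.m⊔n≤o⇒n≤o M N q)) ⟩
    η ℚ.+ η
      ≡⟨ η+η≡ε ⟩
    ε ∎
    where
    open ℚ.≤-Reasoning
    regroup : ∀ a b c d →
      (a ℚ.+ b) ℚ.- (c ℚ.+ d) ≡ (a ℚ.- c) ℚ.+ (b ℚ.- d)
    regroup = solve 4 (λ a b c d →
      (a :+ b) :- (c :+ d) := (a :- c) :+ (b :- d)) refl

  neg-cauchy : ∀ {s} → IsCauchy s → IsCauchy (λ n → ℚ.- s n)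
  neg-cauchy {s} cs ε 0<ε with cs ε 0<ε
  ... | N , hs = N , λ m n p q → subst (ℚ._< ε)
    (trans (sym (ℚ.∣-p∣≡∣p∣ (s m ℚ.- s n))) (cong ℚ.∣_∣ (neg-sub (s m) (s n))))
    (hs m n p q)
    where
    neg-sub : ∀ a b → ℚ.- (a ℚ.- b) ≡ ℚ.- a ℚ.- ℚ.- b
    neg-sub = solve 2 (λ a b → :- (a :- b) := :- a :- :- b) refl

  EventuallyBoundedBy : (ℕ → ℚ) → ℚ → Set
  EventuallyBoundedBy s b = ∃ λ N → ∀ n → N ℕ.≤ n → ℚ.∣ s n ∣ ℚ.≤ b

  bounded : ∀ {s} → IsCauchy s →
            ∃ λ b → 0ℚ ℚ.< b × EventuallyBoundedBy s b
  bounded {s} cs with cs 1ℚ (ℚ.positive⁻¹ 1ℚ)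
  ... | N , h = 1ℚ ℚ.+ ℚ.∣ s N ∣ ,
    ℚ.+-mono-<-≤ (ℚ.positive⁻¹ 1ℚ) (ℚ.0≤∣p∣ (s N)) ,
    N , λ n p → begin
      ℚ.∣ s n ∣                               ≡⟨ cong ℚ.∣_∣ (sub-add (s n) (s N)) ⟩
      ℚ.∣ (s n ℚ.- s N) ℚ.+ s N ∣             ≤⟨ ℚ.∣p+q∣≤∣p∣+∣q∣ (s n ℚ.- s N) (s N) ⟩
      ℚ.∣ s n ℚ.- s N ∣ ℚ.+ ℚ.∣ s N ∣         ≤⟨ ℚ.+-monoˡ-≤ ℚ.∣ s N ∣ (ℚ.<⇒≤ (h n N p ℕ.≤-refl)) ⟩
      1ℚ ℚ.+ ℚ.∣ s N ∣                        ∎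
    where
    open ℚ.≤-Reasoning
    sub-add : ∀ a b → a ≡ (a ℚ.- b) ℚ.+ b
    sub-add = solve 2 (λ a b → a := (a :- b) :+ b) refl

  divide : ∀ b ε → 0ℚ ℚ.< b → 0ℚ ℚ.< ε → ∃ λ δ → 0ℚ ℚ.< δ × b ℚ.* δ ≡ ε
  divide b ε 0<b 0<ε = r ℚ.* ε ,
    subst (ℚ._< r ℚ.* ε) (ℚ.*-zeroʳ r) (ℚ.*-monoʳ-<-pos r {{r-pos}} 0<ε) ,
    trans (sym (ℚ.*-assoc b r ε))
      (trans (cong (ℚ._* ε) (ℚ.*-inverseʳ b {{b≢0}})) (ℚ.*-identityˡ ε))
    where
    b-pos : ℚ.Positive b
    b-pos = ℚ.positive 0<b
    b≢0 : ℚ.NonZero b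
    b≢0 = ℚ.pos⇒nonZero b {{b-pos}}
    r : ℚ
    r = (ℚ.1/ b) {{b≢0}}
    r-pos : ℚ.Positive r
    r-pos = ℚ.1/pos⇒pos b {{b-pos}}

  *-bound : ∀ {a b} x y → 0ℚ ℚ.< a → ℚ.∣ x ∣ ℚ.≤ a → ℚ.∣ y ∣ ℚ.< b →
            ℚ.∣ x ℚ.* y ∣ ℚ.< a ℚ.* b
  *-bound {a} {b} x y 0<a x≤a y<b = begin-strict
    ℚ.∣ x ℚ.* y ∣          ≡⟨ ℚ.∣p*q∣≡∣p∣*∣q∣ x y ⟩
    ℚ.∣ x ∣ ℚ.* ℚ.∣ y ∣    ≤⟨ ℚ.*-monoʳ-≤-nonNeg ℚ.∣ y ∣ {{ℚ.∣-∣-nonNeg y}} x≤a ⟩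
    a ℚ.* ℚ.∣ y ∣          <⟨ ℚ.*-monoʳ-<-pos a {{ℚ.positive 0<a}} y<b ⟩
    a ℚ.* b                ∎
    where open ℚ.≤-Reasoning

  *-diff-bound : ∀ {a b δ η ζ ε} x y x′ y′ → 0ℚ ℚ.< a → 0ℚ ℚ.< b →
    a ℚ.* δ ≡ ζ → b ℚ.* η ≡ ζ → ζ ℚ.+ ζ ≡ ε →
    ℚ.∣ x ∣ ℚ.≤ a → ℚ.∣ y′ ∣ ℚ.≤ b →
    ℚ.∣ x ℚ.- x′ ∣ ℚ.< η → ℚ.∣ y ℚ.- y′ ∣ ℚ.< δ →
    ℚ.∣ x ℚ.* y ℚ.- x′ ℚ.* y′ ∣ ℚ.< ε
  *-diff-bound {a} {b} {δ} {η} {ζ} {ε} x y x′ y′ 0<a 0<b aδ≡ζ bη≡ζ ζ+ζ≡ε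
    x≤a y′≤b dx dy = begin-strict
    ℚ.∣ x ℚ.* y ℚ.- x′ ℚ.* y′ ∣
      ≡⟨ cong ℚ.∣_∣ (regroup x y x′ y′) ⟩
    ℚ.∣ x ℚ.* (y ℚ.- y′) ℚ.+ y′ ℚ.* (x ℚ.- x′) ∣
      ≤⟨ ℚ.∣p+q∣≤∣p∣+∣q∣ (x ℚ.* (y ℚ.- y′)) (y′ ℚ.* (x ℚ.- x′)) ⟩
    ℚ.∣ x ℚ.* (y ℚ.- y′) ∣ ℚ.+ ℚ.∣ y′ ℚ.* (x ℚ.- x′) ∣
      <⟨ ℚ.+-mono-< (*-bound x (y ℚ.- y′) 0<a x≤a dy)
                    (*-bound y′ (x ℚ.- x′) 0<b y′≤b dx) ⟩
    a ℚ.* δ ℚ.+ b ℚ.* η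
      ≡⟨ cong₂ ℚ._+_ aδ≡ζ bη≡ζ ⟩
    ζ ℚ.+ ζ
      ≡⟨ ζ+ζ≡ε ⟩
    ε ∎
    where
    open ℚ.≤-Reasoning
    regroup : ∀ a b c d →
      a ℚ.* b ℚ.- c ℚ.* d ≡ a ℚ.* (b ℚ.- d) ℚ.+ d ℚ.* (a ℚ.- c)
    regroup = solve 4 (λ a b c d →
      a :* b :- c :* d := a :* (b :- d) :+ d :* (a :- c)) refl

  *-cauchy : ∀ {s t} → IsCauchy s → IsCauchy t → IsCauchy (λ n → s n ℚ.* t n)
  *-cauchy {s} {t} cs ct ε 0<ε =
    let (a , 0<a , K , s≤a)   = bounded {s} cs
        (b , 0<b , L , t≤b)   = bounded {t} ct
        (ζ , 0<ζ , ζ+ζ≡ε)     = halve ε 0<ε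
        (δ , 0<δ , aδ≡ζ)      = divide a ζ 0<a 0<ζ
        (η , 0<η , bη≡ζ)      = divide b ζ 0<b 0<ζ
        (M , hs)              = cs η 0<η
        (N , ht)              = ct δ 0<δ
    in (K ℕ.⊔ L) ℕ.⊔ (M ℕ.⊔ N) , λ m n p q →
    let p₁ = ℕ.m⊔n≤o⇒m≤o (K ℕ.⊔ L) (M ℕ.⊔ N) p
        p₂ = ℕ.m⊔n≤o⇒n≤o (K ℕ.⊔ L) (M ℕ.⊔ N) p
        q₁ = ℕ.m⊔n≤o⇒m≤o (K ℕ.⊔ L) (M ℕ.⊔ N) q
        q₂ = ℕ.m⊔n≤o⇒n≤o (K ℕ.⊔ L) (M ℕ.⊔ N) q
    in *-diff-bound {a} {b} {δ} {η} {ζ} {ε} (s m) (t m) (s n) (t n) 0<a 0<b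
        aδ≡ζ bη≡ζ ζ+ζ≡ε
        (s≤a m (ℕ.m⊔n≤o⇒m≤o K L p₁)) (t≤b n (ℕ.m⊔n≤o⇒n≤o K L q₁))
        (hs m n (ℕ.m⊔n≤o⇒m≤o M N p₂) (ℕ.m⊔n≤o⇒m≤o M N q₂))
        (ht m n (ℕ.m⊔n≤o⇒n≤o M N p₂) (ℕ.m⊔n≤o⇒n≤o M N q₂))

_+ᴿ_ : ℝ → ℝ → ℝ
x +ᴿ y = mkℝ (λ n → seq x n ℚ.+ seq y n)
             (+-cauchy {seq x} {seq y} (isCauchy x) (isCauchy y))

-ᴿ_ : ℝ → ℝ
-ᴿ x = mkℝ (λ n → ℚ.- seq x n) (neg-cauchy {seq x} (isCauchy x))

_*ᴿ_ : ℝ → ℝ → ℝ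
x *ᴿ y = mkℝ (λ n → seq x n ℚ.* seq y n)
             (*-cauchy {seq x} {seq y} (isCauchy x) (isCauchy y))

-- A polynomial is its list of coefficients, constant term first; trailing zeros
-- are allowed, and coefficients past the end are 0.
Poly : Set
Poly = List ℝ

coeff : Poly → ℕ → ℝ
coeff []      _       = 0ℝ
coeff (a ∷ P) zero    = a
coeff (a ∷ P) (suc k) = coeff P k

infix  4 _≪_
infixl 6 _+ᴾ_ _-ᴾ_
infixl 7 _*ᴾ_

_+ᴾ_ : Poly → Poly → Poly
[]      +ᴾ R       = R
P       +ᴾ []      = P
(a ∷ P) +ᴾ (b ∷ R) = (a +ᴿ b) ∷ (P +ᴾ R)

_-ᴾ_ : Poly → Poly → Poly
P -ᴾ R = P +ᴾ map -ᴿ_ R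

-- (a + q P) R = a R + q (P R)
_*ᴾ_ : Poly → Poly → Poly
[]      *ᴾ R = []
(a ∷ P) *ᴾ R = map (a *ᴿ_) R +ᴾ (0ℝ ∷ (P *ᴾ R))

monomial : ℝ → ℕ → Poly
monomial a k = replicate k 0ℝ ++ (a ∷ [])

_≪_ : Poly → Poly → Set
P ≪ R = ∀ k → 0ℝ ≤ᴿ coeff (R -ᴾ P) k

-- Every subset of an n-element set, each listed exactly once.
subsets : ∀ n → List (Subset n)
subsets zero    = [] ∷ []
subsets (suc n) = map (outside ∷_) (subsets n) ++ map (inside ∷_) (subsets n)

-- Σ_A α(A) q^|A|
genPoly : ∀ {n} → (Subset n → ℝ) → Poly
genPoly {n} α = foldr _+ᴾ_ [] (map (λ A → monomial (α A) ∣ A ∣) (subsets n))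

-- Σ_{|A|+|B|=k} α(A) β(B)
pairSum : ∀ {n} → (Subset n → ℝ) → (Subset n → ℝ) → ℕ → ℝ
pairSum {n} α β k =
  foldr _+ᴿ_ 0ℝ
    (map (λ (A , B) → α A *ᴿ β B)
      (filter (λ (A , B) → ∣ A ∣ ℕ.+ ∣ B ∣ ℕ.≟ k)
        (cartesianProduct (subsets n) (subsets n))))

{-# OPTIONS --safe #-}

-- Group the pairs (A , B) by I = A ∩ B and J = A ∪ B.  Since |A| + |B| = |I| + |J|
-- is constant on a group, it suffices to compare the two sums group by group.
-- Within a group A = I ∪ X and B = I ∪ (∁ X) with X ranging over the subsets of
-- J \ I and ∁ X = (J \ I) \ X, so the claim becomes Σ f ≤ Σ g for f X = α X β (∁ X), g X = γ X δ (∁ X).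
-- Multiplying the hypotheses for (A , B) and (∁ B , ∁ A) gives
-- f A · f (∁ B) ≤ g (A ∪ B) · g (∁ (A ∩ B)), so the four functions theorem of
-- Ahlswede and Daykin yields (Σ f)² ≤ (Σ g)².
module Submission where

open import Defs

import Algebra.Lattice.Properties.BooleanAlgebra as BooleanAlgebraProperties
open import Data.Bool.Base using (Bool; true; false; if_then_else_)
open import Data.Fin.Subset using (Subset; inside; outside; _∪_; _∩_; ∁; ∣_∣)
open import Data.Fin.Subset.Properties using (∪-∩-booleanAlgebra; ∪-comm; ∩-comm)
open import Data.List.Base
  using (List; []; _∷_; _++_; map; foldr; filter; cartesianProduct)
open import Data.Nat.Base as ℕ using (ℕ; zero; suc; NonZero; _≡ᵇ_)
import Data.Nat.Properties as ℕ
open import Data.Product.Base using (∃; _×_; _,_; uncurry)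
open import Data.Rational.Base as ℚ using (ℚ; 0ℚ; 1ℚ; ½)
import Data.Rational.Properties as ℚ
open import Data.Rational.Solver using (module +-*-Solver)
open import Data.Sum.Base using (inj₁; inj₂)
open import Data.Vec.Base using (Vec; []; _∷_)
open import Function.Base using (_∘_)
open import Relation.Binary.Bundles using (Preorder)
open import Relation.Binary.PropositionalEquality
  using (_≡_; refl; sym; trans; cong; cong₂; subst)
import Relation.Binary.Reasoning.Preorder as PreorderReasoning
open import Relation.Nullary.Decidable.Core using (does; yes; no)
open import Relation.Nullary.Negation.Core using (contradiction)
open import Relation.Unary using (Decidable)

open +-*-Solver using (solve; _:=_; _:+_; _:*_; _:-_; con)

-- Termwise equality of representatives and the ring identities

infix 4 _≈_ _≼_

-- Equality of representing sequences, finer than equality of real numbers: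
-- every ring identity already holds at this level.
record _≈_ (x y : ℝ) : Set where
  constructor pointwise
  field at : ∀ n → seq x n ≡ seq y n

open _≈_

-- A record around _≤ᴿ_, so that x and y can be inferred from a proof.
record _≼_ (x y : ℝ) : Set where
  constructor wrap
  field unwrap : x ≤ᴿ y

open _≼_

≈-refl : ∀ {x} → x ≈ x
≈-refl = pointwise λ _ → refl

≈-sym : ∀ {x y} → x ≈ y → y ≈ x
≈-sym p = pointwise λ n → sym (at p n)

≈-trans : ∀ {x y z} → x ≈ y → y ≈ z → x ≈ z
≈-trans p q = pointwise λ n → trans (at p n) (at q n)

≈-reflexive : ∀ {x y} → x ≡ y → x ≈ y
≈-reflexive refl = ≈-refl

+-cong : ∀ {x x′ y y′} → x ≈ x′ → y ≈ y′ → x +ᴿ y ≈ x′ +ᴿ y′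
+-cong p q = pointwise λ n → cong₂ ℚ._+_ (at p n) (at q n)

*-cong : ∀ {x x′ y y′} → x ≈ x′ → y ≈ y′ → x *ᴿ y ≈ x′ *ᴿ y′
*-cong p q = pointwise λ n → cong₂ ℚ._*_ (at p n) (at q n)

neg-cong : ∀ {x y} → x ≈ y → -ᴿ x ≈ -ᴿ y
neg-cong p = pointwise λ n → cong ℚ.-_ (at p n)

+-identityˡ : ∀ x → 0ℝ +ᴿ x ≈ x
+-identityˡ x = pointwise λ n → ℚ.+-identityˡ (seq x n)

+-identityʳ : ∀ x → x +ᴿ 0ℝ ≈ x
+-identityʳ x = pointwise λ n → ℚ.+-identityʳ (seq x n)

+-comm : ∀ x y → x +ᴿ y ≈ y +ᴿ x
+-comm x y = pointwise λ n → ℚ.+-comm (seq x n) (seq y n)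

+-assoc : ∀ x y z → (x +ᴿ y) +ᴿ z ≈ x +ᴿ (y +ᴿ z)
+-assoc x y z = pointwise λ n → ℚ.+-assoc (seq x n) (seq y n) (seq z n)

+-interchange : ∀ x y z w → (x +ᴿ y) +ᴿ (z +ᴿ w) ≈ (x +ᴿ z) +ᴿ (y +ᴿ w)
+-interchange x y z w = pointwise λ n →
  solve 4 (λ x y z w → (x :+ y) :+ (z :+ w) := (x :+ z) :+ (y :+ w)) refl
    (seq x n) (seq y n) (seq z n) (seq w n)

*-comm : ∀ x y → x *ᴿ y ≈ y *ᴿ x
*-comm x y = pointwise λ n → ℚ.*-comm (seq x n) (seq y n)

*-zeroˡ : ∀ x → 0ℝ *ᴿ x ≈ 0ℝ
*-zeroˡ x = pointwise λ n → ℚ.*-zeroˡ (seq x n)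

*-zeroʳ : ∀ x → x *ᴿ 0ℝ ≈ 0ℝ
*-zeroʳ x = pointwise λ n → ℚ.*-zeroʳ (seq x n)

*-distribˡ-+ : ∀ x y z → x *ᴿ (y +ᴿ z) ≈ x *ᴿ y +ᴿ x *ᴿ z
*-distribˡ-+ x y z = pointwise λ n → ℚ.*-distribˡ-+ (seq x n) (seq y n) (seq z n)

*-distribʳ-+ : ∀ x y z → (y +ᴿ z) *ᴿ x ≈ y *ᴿ x +ᴿ z *ᴿ x
*-distribʳ-+ x y z = pointwise λ n → ℚ.*-distribʳ-+ (seq x n) (seq y n) (seq z n)

-- The ordered ring of real numbers

0<½*ε : ∀ {ε} → 0ℚ ℚ.< ε → 0ℚ ℚ.< ½ ℚ.* ε
0<½*ε {ε} 0<ε = subst (ℚ._< ½ ℚ.* ε) (ℚ.*-zeroʳ ½) (ℚ.*-monoʳ-<-pos ½ 0<ε)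

½*ε+½*ε≡ε : ∀ ε → ½ ℚ.* ε ℚ.+ ½ ℚ.* ε ≡ ε
½*ε+½*ε≡ε ε = trans (sym (ℚ.*-distribʳ-+ ε ½ ½)) (ℚ.*-identityˡ ε)

≼-reflexive : ∀ {x y} → x ≈ y → x ≼ y
≼-reflexive {x} {y} x≈y = wrap λ ε 0<ε → 0 , λ n _ → begin
  seq x n            ≡⟨ at x≈y n ⟩
  seq y n            ≡⟨ ℚ.+-identityʳ (seq y n) ⟨
  seq y n ℚ.+ 0ℚ     ≤⟨ ℚ.+-monoʳ-≤ (seq y n) (ℚ.<⇒≤ 0<ε) ⟩
  seq y n ℚ.+ ε      ∎
  where open ℚ.≤-Reasoning

+-mono-≼ : ∀ {x x′ y y′} → x ≼ x′ → y ≼ y′ → x +ᴿ y ≼ x′ +ᴿ y′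
+-mono-≼ {x} {x′} {y} {y′} (wrap p) (wrap q) = wrap λ ε 0<ε →
  let η       = ½ ℚ.* ε
      (M , f) = p η (0<½*ε 0<ε)
      (N , g) = q η (0<½*ε 0<ε)
  in M ℕ.⊔ N , λ n M⊔N≤n → begin
    seq x n ℚ.+ seq y n
      ≤⟨ ℚ.+-mono-≤ (f n (ℕ.m⊔n≤o⇒m≤o M N M⊔N≤n)) (g n (ℕ.m⊔n≤o⇒n≤o M N M⊔N≤n)) ⟩
    (seq x′ n ℚ.+ η) ℚ.+ (seq y′ n ℚ.+ η)
      ≡⟨ solve 3 (λ a b e → (a :+ e) :+ (b :+ e) := (a :+ b) :+ (e :+ e)) refl
           (seq x′ n) (seq y′ n) η ⟩
    (seq x′ n ℚ.+ seq y′ n) ℚ.+ (η ℚ.+ η)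
      ≡⟨ cong (seq x′ n ℚ.+ seq y′ n ℚ.+_) (½*ε+½*ε≡ε ε) ⟩
    (seq x′ n ℚ.+ seq y′ n) ℚ.+ ε ∎
  where open ℚ.≤-Reasoning

≼-trans : ∀ {x y z} → x ≼ y → y ≼ z → x ≼ z
≼-trans {x} {y} {z} (wrap p) (wrap q) = wrap λ ε 0<ε →
  let η       = ½ ℚ.* ε
      (M , f) = p η (0<½*ε 0<ε)
      (N , g) = q η (0<½*ε 0<ε)
  in M ℕ.⊔ N , λ n M⊔N≤n → begin
    seq x n
      ≤⟨ f n (ℕ.m⊔n≤o⇒m≤o M N M⊔N≤n) ⟩
    seq y n ℚ.+ η
      ≤⟨ ℚ.+-monoˡ-≤ η (g n (ℕ.m⊔n≤o⇒n≤o M N M⊔N≤n)) ⟩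
    (seq z n ℚ.+ η) ℚ.+ η
      ≡⟨ ℚ.+-assoc (seq z n) η η ⟩
    seq z n ℚ.+ (η ℚ.+ η)
      ≡⟨ cong (seq z n ℚ.+_) (½*ε+½*ε≡ε ε) ⟩
    seq z n ℚ.+ ε ∎
  where open ℚ.≤-Reasoning

EventuallyBelow : ℝ → ℚ → Set
EventuallyBelow x b = ∃ λ N → ∀ n → N ℕ.≤ n → seq x n ℚ.≤ b

-- Past the index that the Cauchy condition gives for tolerance 1, every term lies within 1 of
-- `seq x N`. The absolute value makes the bound non-negative even when x is not.
boundedAbove : ∀ x → ∃ λ b → 0ℚ ℚ.≤ b × EventuallyBelow x b
boundedAbove x with isCauchy x 1ℚ (ℚ.positive⁻¹ 1ℚ)
... | N , close = 1ℚ ℚ.+ ℚ.∣ seq x N ∣ ,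
  ℚ.+-mono-≤ (ℚ.nonNegative⁻¹ 1ℚ) (ℚ.0≤∣p∣ (seq x N)) ,
  N , λ n N≤n → begin
    seq x n
      ≡⟨ solve 2 (λ a b → a := (a :- b) :+ b) refl (seq x n) (seq x N) ⟩
    (seq x n ℚ.- seq x N) ℚ.+ seq x N
      ≤⟨ ℚ.+-mono-≤ (p≤∣p∣ (seq x n ℚ.- seq x N)) (p≤∣p∣ (seq x N)) ⟩
    ℚ.∣ seq x n ℚ.- seq x N ∣ ℚ.+ ℚ.∣ seq x N ∣
      ≤⟨ ℚ.+-monoˡ-≤ ℚ.∣ seq x N ∣ (ℚ.<⇒≤ (close n N N≤n ℕ.≤-refl)) ⟩
    1ℚ ℚ.+ ℚ.∣ seq x N ∣ ∎
  where
  open ℚ.≤-Reasoning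
  p≤∣p∣ : ∀ p → p ℚ.≤ ℚ.∣ p ∣
  p≤∣p∣ p with ℚ.≤-total 0ℚ p
  ... | inj₁ 0≤p = ℚ.≤-reflexive (sym (ℚ.0≤p⇒∣p∣≡p 0≤p))
  ... | inj₂ p≤0 = ℚ.≤-trans p≤0 (ℚ.0≤∣p∣ p)


0≤p*q : ∀ {p q} → 0ℚ ℚ.≤ p → 0ℚ ℚ.≤ q → 0ℚ ℚ.≤ p ℚ.* q
0≤p*q {p} {q} 0≤p 0≤q = ℚ.nonNegative⁻¹ (p ℚ.* q)
  {{ℚ.nonNeg*nonNeg⇒nonNeg p {{ℚ.nonNegative 0≤p}} q {{ℚ.nonNegative 0≤q}}}}

0≤q-p : ∀ {p q} → p ℚ.≤ q → 0ℚ ℚ.≤ q ℚ.- p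
0≤q-p {p} {q} p≤q = subst (ℚ._≤ q ℚ.- p) (ℚ.+-inverseʳ p) (ℚ.+-monoˡ-≤ (ℚ.- p) p≤q)

-- Terms of a non-negative real may dip below 0 by η, and the product then loses at most b η. The
-- sign of p decides which decomposition of p q + b η has only non-negative summands.
0≤p*q+bη : ∀ {b η p q} → 0ℚ ℚ.≤ b → 0ℚ ℚ.≤ η → p ℚ.≤ b → q ℚ.≤ b →
           0ℚ ℚ.≤ p ℚ.+ η → 0ℚ ℚ.≤ q ℚ.+ η → 0ℚ ℚ.≤ p ℚ.* q ℚ.+ b ℚ.* η
0≤p*q+bη {b} {η} {p} {q} 0≤b 0≤η p≤b q≤b 0≤p+η 0≤q+η with ℚ.≤-total 0ℚ p
... | inj₁ 0≤p = subst (0ℚ ℚ.≤_)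
  (solve 4 (λ b e p q → p :* (q :+ e) :+ (b :- p) :* e := p :* q :+ b :* e) refl b η p q)
  (ℚ.+-mono-≤ (0≤p*q 0≤p 0≤q+η) (0≤p*q (0≤q-p p≤b) 0≤η))
... | inj₂ p≤0 = subst (0ℚ ℚ.≤_)
  (solve 4 (λ b e p q → (con 0ℚ :- p) :* (b :- q) :+ b :* (p :+ e) := p :* q :+ b :* e) refl
    b η p q)
  (ℚ.+-mono-≤ (0≤p*q (0≤q-p p≤0) (0≤q-p q≤b)) (0≤p*q 0≤b 0≤p+η))

commonBound : ∀ {p q} → 0ℚ ℚ.≤ p → 0ℚ ℚ.≤ q → ∃ λ b → 0ℚ ℚ.< b × p ℚ.≤ b × q ℚ.≤ b
-- The summand 1 keeps the bound strictly positive when p and q both vanish, so that a tolerance can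
-- be divided by it.
commonBound {p} {q} 0≤p 0≤q = 1ℚ ℚ.+ (p ℚ.+ q) ,
  ℚ.+-mono-<-≤ (ℚ.positive⁻¹ 1ℚ) (ℚ.+-mono-≤ 0≤p 0≤q) ,
  ≤1+ (subst (ℚ._≤ p ℚ.+ q) (ℚ.+-identityʳ p) (ℚ.+-monoʳ-≤ p 0≤q)) ,
  ≤1+ (subst (ℚ._≤ p ℚ.+ q) (ℚ.+-identityˡ q) (ℚ.+-monoˡ-≤ q 0≤p))
  where
  ≤1+ : ∀ {p q} → p ℚ.≤ q → p ℚ.≤ 1ℚ ℚ.+ q
  ≤1+ {p} {q} p≤q = subst (ℚ._≤ 1ℚ ℚ.+ q) (ℚ.+-identityˡ p)
    (ℚ.+-mono-≤ (ℚ.nonNegative⁻¹ 1ℚ) p≤q)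

divide : ∀ {b ε} → 0ℚ ℚ.< b → 0ℚ ℚ.< ε → ∃ λ η → 0ℚ ℚ.< η × b ℚ.* η ≡ ε
divide {b} {ε} 0<b 0<ε = r ℚ.* ε ,
  subst (ℚ._< r ℚ.* ε) (ℚ.*-zeroʳ r)
    (ℚ.*-monoʳ-<-pos r {{ℚ.1/pos⇒pos b {{ℚ.positive 0<b}}}} 0<ε) ,
  trans (sym (ℚ.*-assoc b r ε))
    (trans (cong (ℚ._* ε) (ℚ.*-inverseʳ b {{b≢0}})) (ℚ.*-identityˡ ε))
  where
  b≢0 : ℚ.NonZero b
  b≢0 = ℚ.pos⇒nonZero b {{ℚ.positive 0<b}}
  r : ℚ
  r = (ℚ.1/ b) {{b≢0}}

-- Both factors are taken with tolerance η = ε / b, so the error b η allowed by `0≤p*q+bη` is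
-- exactly ε.
0≼x*y-bounded : ∀ {x y b} → 0ℚ ℚ.< b → EventuallyBelow x b → EventuallyBelow y b →
                0ℝ ≤ᴿ x → 0ℝ ≤ᴿ y → 0ℝ ≤ᴿ x *ᴿ y
0≼x*y-bounded {x} {y} {b} 0<b (Mˣ , x≤b) (Mʸ , y≤b) 0≤x 0≤y ε 0<ε =
  let (η , 0<η , bη≡ε) = divide 0<b 0<ε
      (Nˣ , f)         = 0≤x η 0<η
      (Nʸ , g)         = 0≤y η 0<η
  in (Mˣ ℕ.⊔ Mʸ) ℕ.⊔ (Nˣ ℕ.⊔ Nʸ) , λ n le →
    let leᴹ = ℕ.m⊔n≤o⇒m≤o (Mˣ ℕ.⊔ Mʸ) (Nˣ ℕ.⊔ Nʸ) le
        leᴺ = ℕ.m⊔n≤o⇒n≤o (Mˣ ℕ.⊔ Mʸ) (Nˣ ℕ.⊔ Nʸ) le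
    in subst (λ e → 0ℚ ℚ.≤ seq x n ℚ.* seq y n ℚ.+ e) bη≡ε
      (0≤p*q+bη {b} {η} {seq x n} {seq y n} (ℚ.<⇒≤ 0<b) (ℚ.<⇒≤ 0<η)
        (x≤b n (ℕ.m⊔n≤o⇒m≤o Mˣ Mʸ leᴹ))
        (y≤b n (ℕ.m⊔n≤o⇒n≤o Mˣ Mʸ leᴹ))
        (f n (ℕ.m⊔n≤o⇒m≤o Nˣ Nʸ leᴺ))
        (g n (ℕ.m⊔n≤o⇒n≤o Nˣ Nʸ leᴺ)))

0≼x*y : ∀ {x y} → 0ℝ ≼ x → 0ℝ ≼ y → 0ℝ ≼ x *ᴿ y
0≼x*y {x} {y} (wrap 0≤x) (wrap 0≤y) =
  let (bˣ , 0≤bˣ , Mˣ , x≤bˣ)  = boundedAbove x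
      (bʸ , 0≤bʸ , Mʸ , y≤bʸ)  = boundedAbove y
      (b , 0<b , bˣ≤b , bʸ≤b)  = commonBound 0≤bˣ 0≤bʸ
  in wrap (0≼x*y-bounded {x} {y} 0<b
       (Mˣ , λ n le → ℚ.≤-trans (x≤bˣ n le) bˣ≤b)
       (Mʸ , λ n le → ℚ.≤-trans (y≤bʸ n le) bʸ≤b)
       0≤x 0≤y)

-- If d were positive then so would be w ≥ d, hence w d.  This replaces division
-- by w, for which one would have to decide whether w vanishes.
w*d≼0∧d≼w⇒d≼0 : ∀ {w d} → w *ᴿ d ≼ 0ℝ → d ≼ w → d ≼ 0ℝ
w*d≼0∧d≼w⇒d≼0 {w} {d} (wrap wd≤0) (wrap d≤w) = wrap λ ε 0<ε →
  let η       = ½ ℚ.* ε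
      0<η     = 0<½*ε 0<ε
      -- If d exceeded ε, then w would exceed ε - η = η and w d would exceed η ε; this fixes the
      -- tolerance for w d.
      (M , f) = wd≤0 (η ℚ.* ε)
                  (subst (ℚ._< η ℚ.* ε) (ℚ.*-zeroʳ η)
                    (ℚ.*-monoʳ-<-pos η {{ℚ.positive 0<η}} 0<ε))
      (N , g) = d≤w η 0<η
  in M ℕ.⊔ N , λ n le →
    subst (seq d n ℚ.≤_) (sym (ℚ.+-identityˡ ε))
      (d≤ε ε 0<ε (seq w n) (seq d n)
        (subst (seq w n ℚ.* seq d n ℚ.≤_) (ℚ.+-identityˡ (η ℚ.* ε))
          (f n (ℕ.m⊔n≤o⇒m≤o M N le)))
        (g n (ℕ.m⊔n≤o⇒n≤o M N le)))
  where
  open ℚ.≤-Reasoning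
  d≤ε : ∀ ε → 0ℚ ℚ.< ε → ∀ w d →
        w ℚ.* d ℚ.≤ ½ ℚ.* ε ℚ.* ε → d ℚ.≤ w ℚ.+ ½ ℚ.* ε → d ℚ.≤ ε
  -- Here w and d are single rational terms, so the comparison with ε is decidable, unlike a
  -- comparison of reals.
  d≤ε ε 0<ε w d wd≤ηε d≤w+η with d ℚ.≤? ε
  ... | yes d≤ε = d≤ε
  ... | no  d≰ε = contradiction (begin-strict
    η ℚ.* ε    <⟨ ℚ.*-monoˡ-<-pos ε {{ℚ.positive 0<ε}} η<w ⟩
    w ℚ.* ε    <⟨ ℚ.*-monoʳ-<-pos w {{ℚ.positive (ℚ.<-trans (0<½*ε 0<ε) η<w)}} ε<d ⟩
    w ℚ.* d    ≤⟨ wd≤ηε ⟩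
    η ℚ.* ε    ∎) (ℚ.<-irrefl refl)
    where
    η : ℚ
    η = ½ ℚ.* ε
    ε<d : ε ℚ.< d
    ε<d = ℚ.≰⇒> d≰ε
    η<w : η ℚ.< w
    η<w = begin-strict
      η                    ≡⟨ solve 1 (λ e → e := (e :+ e) :- e) refl η ⟩
      (η ℚ.+ η) ℚ.- η      ≡⟨ cong (ℚ._- η) (½*ε+½*ε≡ε ε) ⟩
      ε ℚ.- η              <⟨ ℚ.+-monoˡ-< (ℚ.- η) ε<d ⟩
      d ℚ.- η              ≤⟨ ℚ.+-monoˡ-≤ (ℚ.- η) d≤w+η ⟩
      (w ℚ.+ η) ℚ.- η      ≡⟨ solve 2 (λ w e → (w :+ e) :- e := w) refl w η ⟩
      w                    ∎

-- Reasoning with inequalities between reals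

≼-preorder : Preorder _ _ _
≼-preorder = record
  { Carrier    = ℝ
  ; _≈_        = _≈_
  ; _≲_        = _≼_
  ; isPreorder = record
    { isEquivalence = record { refl = ≈-refl ; sym = ≈-sym ; trans = ≈-trans }
    ; reflexive     = ≼-reflexive
    ; trans         = ≼-trans
    }
  }

open PreorderReasoning ≼-preorder

≼-refl : ∀ {x} → x ≼ x
≼-refl = ≼-reflexive ≈-refl

-- Reduces an inequality to a non-negative gap p and a ring identity, which the solver checks term
-- by term.
≼-by-difference : ∀ {x y p} → 0ℝ ≼ p → x +ᴿ p ≈ y → x ≼ y
≼-by-difference {x} {y} {p} 0≼p x+p≈y = begin
  x          ≈⟨ +-identityʳ x ⟨
  x +ᴿ 0ℝ    ≲⟨ +-mono-≼ (≼-refl {x}) 0≼p ⟩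
  x +ᴿ p     ≈⟨ x+p≈y ⟩
  y          ∎

0≼difference : ∀ {x y} → x ≼ y → 0ℝ ≼ y +ᴿ -ᴿ x
0≼difference {x} {y} x≼y = begin
  0ℝ           ≈⟨ pointwise (λ n → ℚ.+-inverseʳ (seq x n)) ⟨
  x +ᴿ -ᴿ x    ≲⟨ +-mono-≼ x≼y (≼-refl { -ᴿ x}) ⟩
  y +ᴿ -ᴿ x    ∎

0≼x+y : ∀ {x y} → 0ℝ ≼ x → 0ℝ ≼ y → 0ℝ ≼ x +ᴿ y
0≼x+y 0≼x 0≼y = ≼-trans (≼-reflexive (≈-sym (+-identityˡ 0ℝ))) (+-mono-≼ 0≼x 0≼y)


*-monoʳ-≼ : ∀ {x y z} → 0ℝ ≼ x → y ≼ z → x *ᴿ y ≼ x *ᴿ z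
*-monoʳ-≼ {x} {y} {z} 0≼x y≼z = ≼-by-difference (0≼x*y 0≼x (0≼difference y≼z))
  (pointwise λ n → solve 3 (λ x y z → x :* y :+ x :* (z :- y) := x :* z) refl
    (seq x n) (seq y n) (seq z n))

-- The chain passes through x y′, which is why the signs of x and y′ are the ones assumed.
*-mono-≼ : ∀ {x x′ y y′} → 0ℝ ≼ x → 0ℝ ≼ y′ → x ≼ x′ → y ≼ y′ → x *ᴿ y ≼ x′ *ᴿ y′
*-mono-≼ {x} {x′} {y} {y′} 0≼x 0≼y′ x≼x′ y≼y′ = begin
  x *ᴿ y      ≲⟨ *-monoʳ-≼ 0≼x y≼y′ ⟩
  x *ᴿ y′     ≈⟨ *-comm x y′ ⟩
  y′ *ᴿ x     ≲⟨ *-monoʳ-≼ 0≼y′ x≼x′ ⟩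
  y′ *ᴿ x′    ≈⟨ *-comm y′ x′ ⟩
  x′ *ᴿ y′    ∎

≼-by-nonpositive-difference : ∀ {x y} → x +ᴿ -ᴿ y ≼ 0ℝ → x ≼ y
≼-by-nonpositive-difference {x} {y} x-y≼0 = ≼-by-difference (0≼difference x-y≼0)
  (pointwise λ n → solve 2 (λ x y → x :+ (con 0ℚ :- (x :- y)) := y) refl (seq x n) (seq y n))

-- Take w = s + t and d = s - t: then w d = s² - t² ≼ 0, and w - d = 2 t is non-negative, so d ≼ 0.
square-cancel-≼ : ∀ {s t} → 0ℝ ≼ t → s *ᴿ s ≼ t *ᴿ t → s ≼ t
square-cancel-≼ {s} {t} 0≼t ss≼tt =
  ≼-by-nonpositive-difference (w*d≼0∧d≼w⇒d≼0 {s +ᴿ t} {s +ᴿ -ᴿ t}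
  (≼-by-difference (0≼difference ss≼tt)
    (pointwise λ n → solve 2
      (λ s t → (s :+ t) :* (s :- t) :+ (t :* t :- s :* s) := con 0ℚ) refl
      (seq s n) (seq t n)))
  (≼-by-difference (0≼x+y 0≼t 0≼t)
    (pointwise λ n → solve 2
      (λ s t → (s :- t) :+ (t :+ t) := s :+ t) refl
      (seq s n) (seq t n))))

-- Here w (u + v - (w + z)) = (u v - w z) - (w - u) (w - v).
u+v≼w+z : ∀ {u v w z} → 0ℝ ≼ z → u ≼ w → v ≼ w → u *ᴿ v ≼ w *ᴿ z → u +ᴿ v ≼ w +ᴿ z
u+v≼w+z {u} {v} {w} {z} 0≼z u≼w v≼w uv≼wz =
  ≼-by-nonpositive-difference (w*d≼0∧d≼w⇒d≼0 {w} {(u +ᴿ v) +ᴿ -ᴿ (w +ᴿ z)}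
    (≼-by-difference
      (0≼x+y (0≼difference uv≼wz) (0≼x*y (0≼difference u≼w) (0≼difference v≼w)))
      (pointwise λ n → solve 4
        (λ u v w z → w :* ((u :+ v) :- (w :+ z))
                     :+ ((w :* z :- u :* v) :+ (w :- u) :* (w :- v)) := con 0ℚ) refl
        (seq u n) (seq v n) (seq w n) (seq z n)))
    (≼-by-difference
      (0≼x+y 0≼z (0≼x+y (0≼difference u≼w) (0≼difference v≼w)))
      (pointwise λ n → solve 4
        (λ u v w z → ((u :+ v) :- (w :+ z)) :+ (z :+ ((w :- u) :+ (w :- v))) := w) refl
        (seq u n) (seq v n) (seq w n) (seq z n))))

-- Sums over subsets

-- The first coordinate is summed innermost, so a sum over `Subset (suc n)` is by definition a sum
-- over `Subset n` of a folded function. The induction in `fourFunctions` rests on this.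
∑ : ∀ {n} → (Subset n → ℝ) → ℝ
∑ {zero}  f = f []
∑ {suc n} f = ∑ λ A → f (outside ∷ A) +ᴿ f (inside ∷ A)

∑-cong : ∀ {n} {f g : Subset n → ℝ} → (∀ A → f A ≈ g A) → ∑ f ≈ ∑ g
∑-cong {zero}  f≈g = f≈g []
∑-cong {suc n} f≈g = ∑-cong λ A → +-cong (f≈g (outside ∷ A)) (f≈g (inside ∷ A))

0≼∑ : ∀ {n} {f : Subset n → ℝ} → (∀ A → 0ℝ ≼ f A) → 0ℝ ≼ ∑ f
0≼∑ {zero}  0≼f = 0≼f []
0≼∑ {suc n} 0≼f = 0≼∑ λ A → 0≼x+y (0≼f (outside ∷ A)) (0≼f (inside ∷ A))

∑-+ : ∀ {n} (f g : Subset n → ℝ) → ∑ (λ A → f A +ᴿ g A) ≈ ∑ f +ᴿ ∑ g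
∑-+ {zero}  f g = ≈-refl
∑-+ {suc n} f g = ≈-trans
  (∑-cong λ A → +-interchange (f (outside ∷ A)) (g (outside ∷ A))
                              (f (inside ∷ A)) (g (inside ∷ A)))
  (∑-+ (λ A → f (outside ∷ A) +ᴿ f (inside ∷ A))
       (λ A → g (outside ∷ A) +ᴿ g (inside ∷ A)))

∑-∁ : ∀ {n} (f : Subset n → ℝ) → ∑ (f ∘ ∁) ≈ ∑ f
∑-∁ {zero}  f = ≈-refl
∑-∁ {suc n} f = ≈-trans
  (∑-cong λ A → +-comm (f (inside ∷ ∁ A)) (f (outside ∷ ∁ A)))
  (∑-∁ λ A → f (outside ∷ A) +ᴿ f (inside ∷ A))

-- The four functions theorem and sums over complementary pairs

fourFunctions₁ : ∀ {a₀ a₁ b₀ b₁ c₀ c₁ d₀ d₁} →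
  0ℝ ≼ a₀ → 0ℝ ≼ a₁ → 0ℝ ≼ b₀ → 0ℝ ≼ b₁ →
  0ℝ ≼ c₀ → 0ℝ ≼ c₁ → 0ℝ ≼ d₀ → 0ℝ ≼ d₁ →
  a₀ *ᴿ b₀ ≼ c₀ *ᴿ d₀ → a₀ *ᴿ b₁ ≼ c₁ *ᴿ d₀ →
  a₁ *ᴿ b₀ ≼ c₁ *ᴿ d₀ → a₁ *ᴿ b₁ ≼ c₁ *ᴿ d₁ →
  (a₀ +ᴿ a₁) *ᴿ (b₀ +ᴿ b₁) ≼ (c₀ +ᴿ c₁) *ᴿ (d₀ +ᴿ d₁)
fourFunctions₁ {a₀} {a₁} {b₀} {b₁} {c₀} {c₁} {d₀} {d₁}
  0≼a₀ 0≼a₁ 0≼b₀ 0≼b₁ 0≼c₀ 0≼c₁ 0≼d₀ 0≼d₁ h₀₀ h₀₁ h₁₀ h₁₁ = begin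
  (a₀ +ᴿ a₁) *ᴿ (b₀ +ᴿ b₁)
    ≈⟨ expand a₀ a₁ b₀ b₁ ⟩
  (a₀ *ᴿ b₀ +ᴿ a₁ *ᴿ b₁) +ᴿ (a₀ *ᴿ b₁ +ᴿ a₁ *ᴿ b₀)
    -- The mixed products u = a₀ b₁ and v = a₁ b₀ are both bounded by w = c₁ d₀, so they cannot be
    -- compared one by one with w and z = c₀ d₁. The extreme hypotheses multiplied together give u v
    -- ≼ w z, hence u + v ≼ w + z.
    ≲⟨ +-mono-≼ (+-mono-≼ h₀₀ h₁₁) (u+v≼w+z (0≼x*y 0≼c₀ 0≼d₁) h₀₁ h₁₀ cross) ⟩
  (c₀ *ᴿ d₀ +ᴿ c₁ *ᴿ d₁) +ᴿ (c₁ *ᴿ d₀ +ᴿ c₀ *ᴿ d₁)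
    ≈⟨ +-cong ≈-refl (+-comm (c₁ *ᴿ d₀) (c₀ *ᴿ d₁)) ⟩
  (c₀ *ᴿ d₀ +ᴿ c₁ *ᴿ d₁) +ᴿ (c₀ *ᴿ d₁ +ᴿ c₁ *ᴿ d₀)
    ≈⟨ expand c₀ c₁ d₀ d₁ ⟨
  (c₀ +ᴿ c₁) *ᴿ (d₀ +ᴿ d₁) ∎
  where
  expand : ∀ x y z w → (x +ᴿ y) *ᴿ (z +ᴿ w) ≈ (x *ᴿ z +ᴿ y *ᴿ w) +ᴿ (x *ᴿ w +ᴿ y *ᴿ z)
  expand x y z w = pointwise λ n → solve 4
    (λ x y z w → (x :+ y) :* (z :+ w) := (x :* z :+ y :* w) :+ (x :* w :+ y :* z)) refl
    (seq x n) (seq y n) (seq z n) (seq w n)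
  swap : ∀ x y z w → (x *ᴿ y) *ᴿ (z *ᴿ w) ≈ (z *ᴿ y) *ᴿ (x *ᴿ w)
  swap x y z w = pointwise λ n → solve 4
    (λ x y z w → (x :* y) :* (z :* w) := (z :* y) :* (x :* w)) refl
    (seq x n) (seq y n) (seq z n) (seq w n)
  cross : (a₀ *ᴿ b₁) *ᴿ (a₁ *ᴿ b₀) ≼ (c₁ *ᴿ d₀) *ᴿ (c₀ *ᴿ d₁)
  cross = begin
    (a₀ *ᴿ b₁) *ᴿ (a₁ *ᴿ b₀)    ≈⟨ swap a₀ b₁ a₁ b₀ ⟩
    (a₁ *ᴿ b₁) *ᴿ (a₀ *ᴿ b₀)    ≲⟨ *-mono-≼ (0≼x*y 0≼a₁ 0≼b₁) (0≼x*y 0≼c₀ 0≼d₀) h₁₁ h₀₀ ⟩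
    (c₁ *ᴿ d₁) *ᴿ (c₀ *ᴿ d₀)    ≈⟨ *-comm (c₁ *ᴿ d₁) (c₀ *ᴿ d₀) ⟩
    (c₀ *ᴿ d₀) *ᴿ (c₁ *ᴿ d₁)    ≈⟨ swap c₀ d₀ c₁ d₁ ⟩
    (c₁ *ᴿ d₀) *ᴿ (c₀ *ᴿ d₁)    ∎

-- Induction on n: summing out the first coordinate gives four functions on `Subset n`, and the
-- one-element case shows that they again satisfy the hypothesis.
fourFunctions : ∀ {n} {α β γ δ : Subset n → ℝ} →
  (∀ A → 0ℝ ≼ α A) → (∀ A → 0ℝ ≼ β A) → (∀ A → 0ℝ ≼ γ A) → (∀ A → 0ℝ ≼ δ A) →
  (∀ A B → α A *ᴿ β B ≼ γ (A ∪ B) *ᴿ δ (A ∩ B)) →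
  ∑ α *ᴿ ∑ β ≼ ∑ γ *ᴿ ∑ δ
fourFunctions {zero}  0≼α 0≼β 0≼γ 0≼δ h = h [] []
fourFunctions {suc n} 0≼α 0≼β 0≼γ 0≼δ h = fourFunctions
  (λ A → 0≼x+y (0≼α (outside ∷ A)) (0≼α (inside ∷ A)))
  (λ A → 0≼x+y (0≼β (outside ∷ A)) (0≼β (inside ∷ A)))
  (λ A → 0≼x+y (0≼γ (outside ∷ A)) (0≼γ (inside ∷ A)))
  (λ A → 0≼x+y (0≼δ (outside ∷ A)) (0≼δ (inside ∷ A)))
  (λ A B → fourFunctions₁
    (0≼α (outside ∷ A)) (0≼α (inside ∷ A)) (0≼β (outside ∷ B)) (0≼β (inside ∷ B))
    (0≼γ (outside ∷ A ∪ B)) (0≼γ (inside ∷ A ∪ B))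
    (0≼δ (outside ∷ A ∩ B)) (0≼δ (inside ∷ A ∩ B))
    (h (outside ∷ A) (outside ∷ B)) (h (outside ∷ A) (inside ∷ B))
    (h (inside ∷ A) (outside ∷ B)) (h (inside ∷ A) (inside ∷ B)))

-- The weighted Marica–Schönheim inequality.
complementarySum-mono : ∀ {n} {α β γ δ : Subset n → ℝ} →
  (∀ A → 0ℝ ≼ α A) → (∀ A → 0ℝ ≼ β A) → (∀ A → 0ℝ ≼ γ A) → (∀ A → 0ℝ ≼ δ A) →
  (∀ A B → α A *ᴿ β B ≼ γ (A ∪ B) *ᴿ δ (A ∩ B)) →
  ∑ (λ X → α X *ᴿ β (∁ X)) ≼ ∑ (λ X → γ X *ᴿ δ (∁ X))
complementarySum-mono {n} {α} {β} {γ} {δ} 0≼α 0≼β 0≼γ 0≼δ h =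
  square-cancel-≼ (0≼∑ 0≼g) (begin
    ∑ f *ᴿ ∑ f          ≈⟨ *-cong ≈-refl (∑-∁ f) ⟨
    ∑ f *ᴿ ∑ (f ∘ ∁)    ≲⟨ fourFunctions 0≼f (0≼f ∘ ∁) 0≼g (0≼g ∘ ∁) f*f≼g*g ⟩
    ∑ g *ᴿ ∑ (g ∘ ∁)    ≈⟨ *-cong ≈-refl (∑-∁ g) ⟩
    ∑ g *ᴿ ∑ g          ∎)
  where
  open BooleanAlgebraProperties (∪-∩-booleanAlgebra n)
    using (¬-involutive; deMorgan₁; deMorgan₂)
  f g : Subset n → ℝ
  f X = α X *ᴿ β (∁ X)
  g X = γ X *ᴿ δ (∁ X)
  0≼f : ∀ X → 0ℝ ≼ f X
  0≼f X = 0≼x*y (0≼α X) (0≼β (∁ X))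
  0≼g : ∀ X → 0ℝ ≼ g X
  0≼g X = 0≼x*y (0≼γ X) (0≼δ (∁ X))
  f*f≼g*g : ∀ A B → f A *ᴿ f (∁ B) ≼ g (A ∪ B) *ᴿ g (∁ (A ∩ B))
  f*f≼g*g A B = begin
    (α A *ᴿ β (∁ A)) *ᴿ (α (∁ B) *ᴿ β (∁ (∁ B)))
      ≡⟨ cong (λ X → (α A *ᴿ β (∁ A)) *ᴿ (α (∁ B) *ᴿ β X)) (¬-involutive B) ⟩
    (α A *ᴿ β (∁ A)) *ᴿ (α (∁ B) *ᴿ β B)
      ≈⟨ swap (α A) (β (∁ A)) (α (∁ B)) (β B) ⟩
    (α A *ᴿ β B) *ᴿ (α (∁ B) *ᴿ β (∁ A))
      ≲⟨ *-mono-≼ (0≼x*y (0≼α A) (0≼β B)) (0≼x*y (0≼γ _) (0≼δ _)) (h A B) (h (∁ B) (∁ A)) ⟩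
    (γ (A ∪ B) *ᴿ δ (A ∩ B)) *ᴿ (γ (∁ B ∪ ∁ A) *ᴿ δ (∁ B ∩ ∁ A))
      -- De Morgan makes the second union and intersection the complements of the first intersection
      -- and union, so each γ can be regrouped with the δ at its complement.
      ≡⟨ cong₂ (λ X Y → (γ (A ∪ B) *ᴿ δ (A ∩ B)) *ᴿ (γ X *ᴿ δ Y))
           (trans (∪-comm (∁ B) (∁ A)) (sym (deMorgan₁ A B)))
           (trans (∩-comm (∁ B) (∁ A)) (sym (deMorgan₂ A B))) ⟩
    (γ (A ∪ B) *ᴿ δ (A ∩ B)) *ᴿ (γ (∁ (A ∩ B)) *ᴿ δ (∁ (A ∪ B)))
      ≈⟨ swap (γ (A ∪ B)) (δ (∁ (A ∪ B))) (γ (∁ (A ∩ B))) (δ (A ∩ B)) ⟨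
    (γ (A ∪ B) *ᴿ δ (∁ (A ∪ B))) *ᴿ (γ (∁ (A ∩ B)) *ᴿ δ (A ∩ B))
      ≡⟨ cong (λ X → (γ (A ∪ B) *ᴿ δ (∁ (A ∪ B))) *ᴿ (γ (∁ (A ∩ B)) *ᴿ δ X))
           (¬-involutive (A ∩ B)) ⟨
    (γ (A ∪ B) *ᴿ δ (∁ (A ∪ B))) *ᴿ (γ (∁ (A ∩ B)) *ᴿ δ (∁ (∁ (A ∩ B)))) ∎
    where
    swap : ∀ x y z w → (x *ᴿ y) *ᴿ (z *ᴿ w) ≈ (x *ᴿ w) *ᴿ (z *ᴿ y)
    swap x y z w = pointwise λ n → solve 4
      (λ x y z w → (x :* y) :* (z :* w) := (x :* w) :* (z :* y)) refl
      (seq x n) (seq y n) (seq z n) (seq w n)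

-- Pairs (A , B) with prescribed intersection and union

-- How many of A and B contain a given element. A pattern thus encodes A ∩ B (the entries `both`)
-- together with A ∪ B (all entries except `neither`).
data Position : Set where
  neither one both : Position

Pattern : ℕ → Set
Pattern = Vec Position

#one : ∀ {n} → Pattern n → ℕ
#one []            = 0
#one (neither ∷ t) = #one t
#one (one     ∷ t) = suc (#one t)
#one (both    ∷ t) = #one t

-- The pairs of pattern t are exactly (place t X , place t (∁ X)).
place : ∀ {n} (t : Pattern n) → Subset (#one t) → Subset n
place []            X       = []
place (neither ∷ t) X       = outside ∷ place t X
place (one     ∷ t) (x ∷ X) = x ∷ place t X
place (both    ∷ t) X       = inside ∷ place t X

-- Coordinates fixed by t survive because union is idempotent. With `place-∩` this makes `place t` a
-- lattice homomorphism, so the hypothesis on α, β, γ, δ passes to their composites with `place t`.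
place-∪ : ∀ {n} (t : Pattern n) X Y → place t (X ∪ Y) ≡ place t X ∪ place t Y
place-∪ []            X       Y       = refl
place-∪ (neither ∷ t) X       Y       = cong (outside ∷_) (place-∪ t X Y)
place-∪ (one     ∷ t) (x ∷ X) (y ∷ Y) = cong (_ ∷_) (place-∪ t X Y)
place-∪ (both    ∷ t) X       Y       = cong (inside ∷_) (place-∪ t X Y)

place-∩ : ∀ {n} (t : Pattern n) X Y → place t (X ∩ Y) ≡ place t X ∩ place t Y
place-∩ []            X       Y       = refl
place-∩ (neither ∷ t) X       Y       = cong (outside ∷_) (place-∩ t X Y)
place-∩ (one     ∷ t) (x ∷ X) (y ∷ Y) = cong (_ ∷_) (place-∩ t X Y)
place-∩ (both    ∷ t) X       Y       = cong (inside ∷_) (place-∩ t X Y)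

-- This is |I| + |J| for the intersection I and the union J encoded by the pattern.
size : ∀ {n} → Pattern n → ℕ
size []            = 0
size (neither ∷ t) = size t
size (one     ∷ t) = suc (size t)
size (both    ∷ t) = suc (suc (size t))

-- An element at `one` lies in exactly one of the two sets, whichever X is, so the degree is
-- constant on a pattern.
∣place∣ : ∀ {n} (t : Pattern n) X → ∣ place t X ∣ ℕ.+ ∣ place t (∁ X) ∣ ≡ size t
∣place∣ []            X             = refl
∣place∣ (neither ∷ t) X             = ∣place∣ t X
∣place∣ (one     ∷ t) (outside ∷ X) = trans (ℕ.+-suc _ _) (cong suc (∣place∣ t X))
∣place∣ (one     ∷ t) (inside  ∷ X) = cong suc (∣place∣ t X)
∣place∣ (both    ∷ t) X             = cong suc (trans (ℕ.+-suc _ _) (cong suc (∣place∣ t X)))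

-- Double sums split by pattern

patternSum : ∀ {n} → Pattern n → (Subset n → Subset n → ℝ) → ℝ
patternSum t F = ∑ λ X → F (place t X) (place t (∁ X))

∑∑ : ∀ {n} → (Subset n → Subset n → ℝ) → ℝ
∑∑ F = ∑ λ A → ∑ (F A)

-- Splits by the position of the first element. The two mixed terms stay together because both
-- belong to `one`.
∑∑-suc : ∀ {n} (F : Subset (suc n) → Subset (suc n) → ℝ) →
  ∑∑ F ≈ (∑∑ (λ A B → F (outside ∷ A) (outside ∷ B))
          +ᴿ ∑∑ (λ A B → F (outside ∷ A) (inside ∷ B) +ᴿ F (inside ∷ A) (outside ∷ B)))
         +ᴿ ∑∑ (λ A B → F (inside ∷ A) (inside ∷ B))
∑∑-suc F = begin-equality
  ∑ (λ A → ∑ (λ B → F₀₀ A B +ᴿ F₀₁ A B) +ᴿ ∑ (λ B → F₁₀ A B +ᴿ F₁₁ A B))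
    ≈⟨ ∑-cong (λ A → regroup A) ⟩
  ∑ (λ A → (∑ (F₀₀ A) +ᴿ ∑ (λ B → F₀₁ A B +ᴿ F₁₀ A B)) +ᴿ ∑ (F₁₁ A))
    ≈⟨ ∑-+ (λ A → ∑ (F₀₀ A) +ᴿ ∑ (λ B → F₀₁ A B +ᴿ F₁₀ A B)) (λ A → ∑ (F₁₁ A)) ⟩
  ∑ (λ A → ∑ (F₀₀ A) +ᴿ ∑ (λ B → F₀₁ A B +ᴿ F₁₀ A B)) +ᴿ ∑∑ F₁₁
    ≈⟨ +-cong (∑-+ (λ A → ∑ (F₀₀ A)) (λ A → ∑ (λ B → F₀₁ A B +ᴿ F₁₀ A B))) ≈-refl ⟩
  (∑∑ F₀₀ +ᴿ ∑∑ (λ A B → F₀₁ A B +ᴿ F₁₀ A B)) +ᴿ ∑∑ F₁₁ ∎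
  where
  F₀₀ F₀₁ F₁₀ F₁₁ : Subset _ → Subset _ → ℝ
  F₀₀ A B = F (outside ∷ A) (outside ∷ B)
  F₀₁ A B = F (outside ∷ A) (inside ∷ B)
  F₁₀ A B = F (inside ∷ A) (outside ∷ B)
  F₁₁ A B = F (inside ∷ A) (inside ∷ B)
  regroup : ∀ A →
    ∑ (λ B → F₀₀ A B +ᴿ F₀₁ A B) +ᴿ ∑ (λ B → F₁₀ A B +ᴿ F₁₁ A B) ≈
    (∑ (F₀₀ A) +ᴿ ∑ (λ B → F₀₁ A B +ᴿ F₁₀ A B)) +ᴿ ∑ (F₁₁ A)
  regroup A = begin-equality
    ∑ (λ B → F₀₀ A B +ᴿ F₀₁ A B) +ᴿ ∑ (λ B → F₁₀ A B +ᴿ F₁₁ A B)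
      ≈⟨ ∑-+ (λ B → F₀₀ A B +ᴿ F₀₁ A B) (λ B → F₁₀ A B +ᴿ F₁₁ A B) ⟨
    ∑ (λ B → (F₀₀ A B +ᴿ F₀₁ A B) +ᴿ (F₁₀ A B +ᴿ F₁₁ A B))
      ≈⟨ ∑-cong (λ B → pointwise λ n → solve 4
           (λ x y z w → (x :+ y) :+ (z :+ w) := (x :+ (y :+ z)) :+ w) refl
           (seq (F₀₀ A B) n) (seq (F₀₁ A B) n) (seq (F₁₀ A B) n) (seq (F₁₁ A B) n)) ⟩
    ∑ (λ B → (F₀₀ A B +ᴿ (F₀₁ A B +ᴿ F₁₀ A B)) +ᴿ F₁₁ A B)
      ≈⟨ ∑-+ (λ B → F₀₀ A B +ᴿ (F₀₁ A B +ᴿ F₁₀ A B)) (F₁₁ A) ⟩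
    ∑ (λ B → F₀₀ A B +ᴿ (F₀₁ A B +ᴿ F₁₀ A B)) +ᴿ ∑ (F₁₁ A)
      ≈⟨ +-cong (∑-+ (F₀₀ A) (λ B → F₀₁ A B +ᴿ F₁₀ A B)) ≈-refl ⟩
    (∑ (F₀₀ A) +ᴿ ∑ (λ B → F₀₁ A B +ᴿ F₁₀ A B)) +ᴿ ∑ (F₁₁ A) ∎

-- Each pair has exactly one pattern. By definition `patternSum (one ∷ t) F` is the pattern sum over
-- t of the two mixed terms added, so each of the three parts from `∑∑-suc` is an instance of the
-- induction hypothesis.
∑∑-mono-patternwise : ∀ {n} {F G : Subset n → Subset n → ℝ} →
  (∀ t → patternSum t F ≼ patternSum t G) → ∑∑ F ≼ ∑∑ G
∑∑-mono-patternwise {zero}          h = h []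
∑∑-mono-patternwise {suc n} {F} {G} h =
  ≼-trans (≼-reflexive (∑∑-suc F)) (≼-trans
    (+-mono-≼ (+-mono-≼ (∑∑-mono-patternwise λ t → h (neither ∷ t))
                        (∑∑-mono-patternwise λ t → h (one ∷ t)))
              (∑∑-mono-patternwise λ t → h (both ∷ t)))
    (≼-reflexive (≈-sym (∑∑-suc G))))

-- Comparison of the sums in a fixed degree

when : Bool → ℝ → ℝ
when b x = if b then x else 0ℝ

∑-when-mono : ∀ {n} b {f g : Subset n → ℝ} → ∑ f ≼ ∑ g →
              ∑ (λ A → when b (f A)) ≼ ∑ (λ A → when b (g A))
∑-when-mono true  ∑f≼∑g = ∑f≼∑g
∑-when-mono false ∑f≼∑g = ≼-refl

gradedTerm : ∀ {n} → ℕ → (Subset n → ℝ) → (Subset n → ℝ) → Subset n → Subset n → ℝ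
gradedTerm k α β A B = when (∣ A ∣ ℕ.+ ∣ B ∣ ≡ᵇ k) (α A *ᴿ β B)

patternSum-gradedTerm : ∀ {n} k (α β : Subset n → ℝ) t →
  patternSum t (gradedTerm k α β) ≈
  ∑ (λ X → when (size t ≡ᵇ k) (α (place t X) *ᴿ β (place t (∁ X))))
patternSum-gradedTerm k α β t = ∑-cong λ X →
  ≈-reflexive (cong (λ s → when (s ≡ᵇ k) (α (place t X) *ᴿ β (place t (∁ X)))) (∣place∣ t X))

-- On one pattern the degree test is the same for all X, so either every term vanishes or the claim
-- is `complementarySum-mono` for the functions composed with `place t`.
gradedSum-mono : ∀ {n} {α β γ δ : Subset n → ℝ} →
  (∀ A → 0ℝ ≼ α A) → (∀ A → 0ℝ ≼ β A) → (∀ A → 0ℝ ≼ γ A) → (∀ A → 0ℝ ≼ δ A) →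
  (∀ A B → α A *ᴿ β B ≼ γ (A ∪ B) *ᴿ δ (A ∩ B)) →
  ∀ k → ∑∑ (gradedTerm k α β) ≼ ∑∑ (gradedTerm k γ δ)
gradedSum-mono {α = α} {β} {γ} {δ} 0≼α 0≼β 0≼γ 0≼δ h k = ∑∑-mono-patternwise λ t →
  ≼-trans (≼-reflexive (patternSum-gradedTerm k α β t)) (≼-trans
    (∑-when-mono {#one t} (size t ≡ᵇ k) (complementarySum-mono {#one t}
      (0≼α ∘ place t) (0≼β ∘ place t) (0≼γ ∘ place t) (0≼δ ∘ place t) λ X Y →
      subst (α (place t X) *ᴿ β (place t Y) ≼_)
        (sym (cong₂ (λ C D → γ C *ᴿ δ D) (place-∪ t X Y) (place-∩ t X Y)))
        (h (place t X) (place t Y))))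
    (≼-reflexive (≈-sym (patternSum-gradedTerm k γ δ t))))

-- Sums over lists and polynomial coefficients

sumOver : ∀ {a} {I : Set a} → (I → ℝ) → List I → ℝ
sumOver f xs = foldr _+ᴿ_ 0ℝ (map f xs)

sumOver-cong : ∀ {a} {I : Set a} {f g : I → ℝ} → (∀ x → f x ≈ g x) →
               ∀ xs → sumOver f xs ≈ sumOver g xs
sumOver-cong f≈g []       = ≈-refl
sumOver-cong f≈g (x ∷ xs) = +-cong (f≈g x) (sumOver-cong f≈g xs)

sumOver-++ : ∀ {a} {I : Set a} (f : I → ℝ) xs ys →
             sumOver f (xs ++ ys) ≈ sumOver f xs +ᴿ sumOver f ys
sumOver-++ f []       ys = ≈-sym (+-identityˡ (sumOver f ys))
sumOver-++ f (x ∷ xs) ys = ≈-trans (+-cong ≈-refl (sumOver-++ f xs ys))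
  (≈-sym (+-assoc (f x) (sumOver f xs) (sumOver f ys)))

sumOver-map : ∀ {a b} {I : Set a} {J : Set b} (f : J → ℝ) (g : I → J) xs →
              sumOver f (map g xs) ≡ sumOver (f ∘ g) xs
sumOver-map f g []       = refl
sumOver-map f g (x ∷ xs) = cong (f (g x) +ᴿ_) (sumOver-map f g xs)

sumOver-filter : ∀ {a p} {I : Set a} {P : I → Set p} (P? : Decidable P) (f : I → ℝ) xs →
                 sumOver f (filter P? xs) ≈ sumOver (λ x → when (does (P? x)) (f x)) xs
sumOver-filter P? f []       = ≈-refl
sumOver-filter P? f (x ∷ xs) with does (P? x)
... | true  = +-cong ≈-refl (sumOver-filter P? f xs)
... | false = ≈-trans (sumOver-filter P? f xs) (≈-sym (+-identityˡ _))

sumOver-cartesianProduct : ∀ {a b} {I : Set a} {J : Set b} (f : I × J → ℝ) xs ys →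
  sumOver f (cartesianProduct xs ys) ≈ sumOver (λ x → sumOver (λ y → f (x , y)) ys) xs
sumOver-cartesianProduct f []       ys = ≈-refl
sumOver-cartesianProduct f (x ∷ xs) ys = ≈-trans
  (sumOver-++ f (map (x ,_) ys) (cartesianProduct xs ys))
  (+-cong (≈-reflexive (sumOver-map f (x ,_) ys)) (sumOver-cartesianProduct f xs ys))

sumOver-subsets : ∀ {n} (f : Subset n → ℝ) → sumOver f (subsets n) ≈ ∑ f
sumOver-subsets {zero}  f = +-identityʳ (f [])
sumOver-subsets {suc n} f = begin-equality
  sumOver f (map (outside ∷_) (subsets n) ++ map (inside ∷_) (subsets n))
    ≈⟨ sumOver-++ f (map (outside ∷_) (subsets n)) (map (inside ∷_) (subsets n)) ⟩
  sumOver f (map (outside ∷_) (subsets n)) +ᴿ sumOver f (map (inside ∷_) (subsets n))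
    ≡⟨ cong₂ _+ᴿ_ (sumOver-map f (outside ∷_) (subsets n))
                  (sumOver-map f (inside ∷_) (subsets n)) ⟩
  sumOver (f ∘ (outside ∷_)) (subsets n) +ᴿ sumOver (f ∘ (inside ∷_)) (subsets n)
    ≈⟨ +-cong (sumOver-subsets (f ∘ (outside ∷_))) (sumOver-subsets (f ∘ (inside ∷_))) ⟩
  ∑ (f ∘ (outside ∷_)) +ᴿ ∑ (f ∘ (inside ∷_))
    ≈⟨ ∑-+ (f ∘ (outside ∷_)) (f ∘ (inside ∷_)) ⟨
  ∑ f ∎

sumOver-subsets² : ∀ {n} (F : Subset n → Subset n → ℝ) →
  sumOver (λ A → sumOver (F A) (subsets n)) (subsets n) ≈ ∑∑ F
sumOver-subsets² {n} F = ≈-trans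
  (sumOver-cong (λ A → sumOver-subsets (F A)) (subsets n))
  (sumOver-subsets λ A → ∑ (F A))

pairSum≈∑∑ : ∀ {n} (α β : Subset n → ℝ) k → pairSum α β k ≈ ∑∑ (gradedTerm k α β)
pairSum≈∑∑ {n} α β k = begin-equality
  pairSum α β k
    -- The decision `does (m ℕ.≟ k)` reduces to `m ≡ᵇ k`, so the filtered sum is already a sum of
    -- `gradedTerm`.
    ≈⟨ sumOver-filter (λ (A , B) → ∣ A ∣ ℕ.+ ∣ B ∣ ℕ.≟ k) (λ (A , B) → α A *ᴿ β B)
         (cartesianProduct (subsets n) (subsets n)) ⟩
  sumOver (uncurry (gradedTerm k α β)) (cartesianProduct (subsets n) (subsets n))
    ≈⟨ sumOver-cartesianProduct (uncurry (gradedTerm k α β)) (subsets n) (subsets n) ⟩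
  sumOver (λ A → sumOver (gradedTerm k α β A) (subsets n)) (subsets n)
    ≈⟨ sumOver-subsets² (gradedTerm k α β) ⟩
  ∑∑ (gradedTerm k α β) ∎

-- Coefficients of sums and products of polynomials

coeff-+ᴾ : ∀ P R k → coeff (P +ᴾ R) k ≈ coeff P k +ᴿ coeff R k
coeff-+ᴾ []      R       k       = ≈-sym (+-identityˡ (coeff R k))
coeff-+ᴾ (a ∷ P) []      k       = ≈-sym (+-identityʳ (coeff (a ∷ P) k))
coeff-+ᴾ (a ∷ P) (b ∷ R) zero    = ≈-refl
coeff-+ᴾ (a ∷ P) (b ∷ R) (suc k) = coeff-+ᴾ P R k

coeff-map-neg : ∀ P k → coeff (map -ᴿ_ P) k ≈ -ᴿ coeff P k
coeff-map-neg []      k       = pointwise λ _ → refl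
coeff-map-neg (a ∷ P) zero    = ≈-refl
coeff-map-neg (a ∷ P) (suc k) = coeff-map-neg P k

coeff-map-* : ∀ a P k → coeff (map (a *ᴿ_) P) k ≈ a *ᴿ coeff P k
coeff-map-* a []      k       = ≈-sym (*-zeroʳ a)
coeff-map-* a (b ∷ P) zero    = ≈-refl
coeff-map-* a (b ∷ P) (suc k) = coeff-map-* a P k

coeff--ᴾ : ∀ P R k → coeff (P -ᴾ R) k ≈ coeff P k +ᴿ -ᴿ coeff R k
coeff--ᴾ P R k = ≈-trans (coeff-+ᴾ P (map -ᴿ_ R) k) (+-cong ≈-refl (coeff-map-neg R k))

coeff-*ᴾ : ∀ a P R k → coeff ((a ∷ P) *ᴾ R) k ≈ a *ᴿ coeff R k +ᴿ coeff (0ℝ ∷ P *ᴾ R) k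
coeff-*ᴾ a P R k = ≈-trans (coeff-+ᴾ (map (a *ᴿ_) R) (0ℝ ∷ P *ᴾ R) k)
  (+-cong (coeff-map-* a R k) ≈-refl)

-- Prepending `0ℝ` is multiplication by q. It moves the index by one, so the hypothesis is required
-- at every k.
coeff-shift-+ : ∀ P Q S → (∀ k → coeff S k ≈ coeff P k +ᴿ coeff Q k) →
  ∀ k → coeff (0ℝ ∷ S) k ≈ coeff (0ℝ ∷ P) k +ᴿ coeff (0ℝ ∷ Q) k
coeff-shift-+ P Q S S≈P+Q zero    = ≈-sym (+-identityˡ 0ℝ)
coeff-shift-+ P Q S S≈P+Q (suc k) = S≈P+Q k

-- Stated by coefficients because the entries of the two lists are compared only up to `_≈_`.
*ᴾ-distribˡ-+ᴾ : ∀ P Q R k →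
  coeff (P *ᴾ (Q +ᴾ R)) k ≈ coeff (P *ᴾ Q) k +ᴿ coeff (P *ᴾ R) k
*ᴾ-distribˡ-+ᴾ []      Q R k = ≈-sym (+-identityˡ 0ℝ)
*ᴾ-distribˡ-+ᴾ (a ∷ P) Q R k = begin-equality
  coeff ((a ∷ P) *ᴾ (Q +ᴾ R)) k
    ≈⟨ coeff-*ᴾ a P (Q +ᴾ R) k ⟩
  a *ᴿ coeff (Q +ᴾ R) k +ᴿ coeff (0ℝ ∷ P *ᴾ (Q +ᴾ R)) k
    ≈⟨ +-cong
         (≈-trans (*-cong ≈-refl (coeff-+ᴾ Q R k)) (*-distribˡ-+ a (coeff Q k) (coeff R k)))
         (coeff-shift-+ (P *ᴾ Q) (P *ᴾ R) (P *ᴾ (Q +ᴾ R)) (*ᴾ-distribˡ-+ᴾ P Q R) k) ⟩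
  (a *ᴿ coeff Q k +ᴿ a *ᴿ coeff R k) +ᴿ (coeff (0ℝ ∷ P *ᴾ Q) k +ᴿ coeff (0ℝ ∷ P *ᴾ R) k)
    ≈⟨ +-interchange (a *ᴿ coeff Q k) (a *ᴿ coeff R k)
         (coeff (0ℝ ∷ P *ᴾ Q) k) (coeff (0ℝ ∷ P *ᴾ R) k) ⟩
  (a *ᴿ coeff Q k +ᴿ coeff (0ℝ ∷ P *ᴾ Q) k) +ᴿ (a *ᴿ coeff R k +ᴿ coeff (0ℝ ∷ P *ᴾ R) k)
    ≈⟨ +-cong (coeff-*ᴾ a P Q k) (coeff-*ᴾ a P R k) ⟨
  coeff ((a ∷ P) *ᴾ Q) k +ᴿ coeff ((a ∷ P) *ᴾ R) k ∎

*ᴾ-distribʳ-+ᴾ : ∀ P Q R k →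
  coeff ((P +ᴾ Q) *ᴾ R) k ≈ coeff (P *ᴾ R) k +ᴿ coeff (Q *ᴾ R) k
*ᴾ-distribʳ-+ᴾ []      Q       R k = ≈-sym (+-identityˡ (coeff (Q *ᴾ R) k))
*ᴾ-distribʳ-+ᴾ (a ∷ P) []      R k = ≈-sym (+-identityʳ (coeff ((a ∷ P) *ᴾ R) k))
*ᴾ-distribʳ-+ᴾ (a ∷ P) (b ∷ Q) R k = begin-equality
  coeff (((a +ᴿ b) ∷ (P +ᴾ Q)) *ᴾ R) k
    ≈⟨ coeff-*ᴾ (a +ᴿ b) (P +ᴾ Q) R k ⟩
  (a +ᴿ b) *ᴿ coeff R k +ᴿ coeff (0ℝ ∷ (P +ᴾ Q) *ᴾ R) k
    ≈⟨ +-cong (*-distribʳ-+ (coeff R k) a b)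
         (coeff-shift-+ (P *ᴾ R) (Q *ᴾ R) ((P +ᴾ Q) *ᴾ R) (*ᴾ-distribʳ-+ᴾ P Q R) k) ⟩
  (a *ᴿ coeff R k +ᴿ b *ᴿ coeff R k) +ᴿ (coeff (0ℝ ∷ P *ᴾ R) k +ᴿ coeff (0ℝ ∷ Q *ᴾ R) k)
    ≈⟨ +-interchange (a *ᴿ coeff R k) (b *ᴿ coeff R k)
         (coeff (0ℝ ∷ P *ᴾ R) k) (coeff (0ℝ ∷ Q *ᴾ R) k) ⟩
  (a *ᴿ coeff R k +ᴿ coeff (0ℝ ∷ P *ᴾ R) k) +ᴿ (b *ᴿ coeff R k +ᴿ coeff (0ℝ ∷ Q *ᴾ R) k)
    ≈⟨ +-cong (coeff-*ᴾ a P R k) (coeff-*ᴾ b Q R k) ⟨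
  coeff ((a ∷ P) *ᴾ R) k +ᴿ coeff ((b ∷ Q) *ᴾ R) k ∎

-- The product `P *ᴾ []` is a list of zeros as long as P, not the empty list.
*ᴾ-zeroʳ : ∀ P k → coeff (P *ᴾ []) k ≈ 0ℝ
*ᴾ-zeroʳ []      k       = ≈-refl
*ᴾ-zeroʳ (a ∷ P) zero    = ≈-refl
*ᴾ-zeroʳ (a ∷ P) (suc k) = *ᴾ-zeroʳ P k

coeff-monomial : ∀ a i k → coeff (monomial a i) k ≈ when (i ≡ᵇ k) a
coeff-monomial a zero    zero    = ≈-refl
coeff-monomial a zero    (suc k) = ≈-refl
coeff-monomial a (suc i) zero    = ≈-refl
coeff-monomial a (suc i) (suc k) = coeff-monomial a i k

*-when : ∀ b x y → x *ᴿ when b y ≈ when b (x *ᴿ y)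
*-when true  x y = ≈-refl
*-when false x y = *-zeroʳ x

coeff-monomial-* : ∀ a b i j k →
  coeff (monomial a i *ᴾ monomial b j) k ≈ when (i ℕ.+ j ≡ᵇ k) (a *ᴿ b)
coeff-monomial-* a b zero j k = begin-equality
  coeff (monomial a 0 *ᴾ monomial b j) k
    ≈⟨ coeff-*ᴾ a [] (monomial b j) k ⟩
  a *ᴿ coeff (monomial b j) k +ᴿ coeff (0ℝ ∷ []) k
    ≈⟨ +-cong (*-cong ≈-refl (coeff-monomial b j k)) (coeff-0 k) ⟩
  a *ᴿ when (j ≡ᵇ k) b +ᴿ 0ℝ
    ≈⟨ +-identityʳ (a *ᴿ when (j ≡ᵇ k) b) ⟩
  a *ᴿ when (j ≡ᵇ k) b
    ≈⟨ *-when (j ≡ᵇ k) a b ⟩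
  when (j ≡ᵇ k) (a *ᴿ b) ∎
  where
  coeff-0 : ∀ k → coeff (0ℝ ∷ []) k ≈ 0ℝ
  coeff-0 zero    = ≈-refl
  coeff-0 (suc k) = ≈-refl
coeff-monomial-* a b (suc i) j k = begin-equality
  coeff ((0ℝ ∷ monomial a i) *ᴾ monomial b j) k
    ≈⟨ coeff-*ᴾ 0ℝ (monomial a i) (monomial b j) k ⟩
  0ℝ *ᴿ coeff (monomial b j) k +ᴿ coeff (0ℝ ∷ monomial a i *ᴾ monomial b j) k
    ≈⟨ +-cong (*-zeroˡ (coeff (monomial b j) k)) ≈-refl ⟩
  0ℝ +ᴿ coeff (0ℝ ∷ monomial a i *ᴾ monomial b j) k
    ≈⟨ +-identityˡ (coeff (0ℝ ∷ monomial a i *ᴾ monomial b j) k) ⟩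
  coeff (0ℝ ∷ monomial a i *ᴾ monomial b j) k
    ≈⟨ shifted k ⟩
  when (suc i ℕ.+ j ≡ᵇ k) (a *ᴿ b) ∎
  where
  shifted : ∀ k →
    coeff (0ℝ ∷ monomial a i *ᴾ monomial b j) k ≈ when (suc i ℕ.+ j ≡ᵇ k) (a *ᴿ b)
  -- The exponent `suc i ℕ.+ j` is positive, so the constant coefficient is 0 on both sides.
  shifted zero    = ≈-refl
  shifted (suc k) = coeff-monomial-* a b i j k

-- Products of generating polynomials

sumᴾ : ∀ {a} {I : Set a} → (I → Poly) → List I → Poly
sumᴾ f xs = foldr _+ᴾ_ [] (map f xs)

coeff-sumᴾ-* : ∀ {a} {I : Set a} (f : I → Poly) R k xs →
  coeff (sumᴾ f xs *ᴾ R) k ≈ sumOver (λ x → coeff (f x *ᴾ R) k) xs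
coeff-sumᴾ-* f R k []       = ≈-refl
coeff-sumᴾ-* f R k (x ∷ xs) = ≈-trans (*ᴾ-distribʳ-+ᴾ (f x) (sumᴾ f xs) R k)
  (+-cong ≈-refl (coeff-sumᴾ-* f R k xs))

coeff-*-sumᴾ : ∀ {a} {I : Set a} (f : I → Poly) P k xs →
  coeff (P *ᴾ sumᴾ f xs) k ≈ sumOver (λ x → coeff (P *ᴾ f x) k) xs
coeff-*-sumᴾ f P k []       = *ᴾ-zeroʳ P k
coeff-*-sumᴾ f P k (x ∷ xs) = ≈-trans (*ᴾ-distribˡ-+ᴾ P (f x) (sumᴾ f xs) k)
  (+-cong ≈-refl (coeff-*-sumᴾ f P k xs))

-- Bilinear expansion into products of monomials. The result is the double sum that also equals
-- `pairSum α β k`, so one inequality serves both conclusions of the theorem.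
coeff-genPoly-* : ∀ {n} (α β : Subset n → ℝ) k →
  coeff (genPoly α *ᴾ genPoly β) k ≈ ∑∑ (gradedTerm k α β)
coeff-genPoly-* {n} α β k = begin-equality
  coeff (genPoly α *ᴾ genPoly β) k
    ≈⟨ coeff-sumᴾ-* (λ A → monomial (α A) ∣ A ∣) (genPoly β) k (subsets n) ⟩
  sumOver (λ A → coeff (monomial (α A) ∣ A ∣ *ᴾ genPoly β) k) (subsets n)
    ≈⟨ sumOver-cong (λ A → ≈-trans
         (coeff-*-sumᴾ (λ B → monomial (β B) ∣ B ∣) (monomial (α A) ∣ A ∣) k (subsets n))
         (sumOver-cong (λ B → coeff-monomial-* (α A) (β B) ∣ A ∣ ∣ B ∣ k) (subsets n)))
         (subsets n) ⟩
  sumOver (λ A → sumOver (gradedTerm k α β A) (subsets n)) (subsets n)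
    ≈⟨ sumOver-subsets² (gradedTerm k α β) ⟩
  ∑∑ (gradedTerm k α β) ∎

theorem2p1 : ∀ (n : ℕ) → .{{_ : NonZero n}} →
    (α β γ δ : Subset n → ℝ) →
    (∀ A → 0ℝ ≤ᴿ α A) → (∀ A → 0ℝ ≤ᴿ β A) →
    (∀ A → 0ℝ ≤ᴿ γ A) → (∀ A → 0ℝ ≤ᴿ δ A) →
    (∀ A B → α A *ᴿ β B ≤ᴿ γ (A ∪ B) *ᴿ δ (A ∩ B)) →
    (genPoly α *ᴾ genPoly β ≪ genPoly γ *ᴾ genPoly δ)
    × (∀ (k : ℕ) → pairSum α β k ≤ᴿ pairSum γ δ k)
theorem2p1 n α β γ δ 0≤α 0≤β 0≤γ 0≤δ h =
  (λ k → unwrap (begin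
    0ℝ
      ≲⟨ 0≼difference (graded k) ⟩
    ∑∑ (gradedTerm k γ δ) +ᴿ -ᴿ ∑∑ (gradedTerm k α β)
      ≈⟨ +-cong (coeff-genPoly-* γ δ k) (neg-cong (coeff-genPoly-* α β k)) ⟨
    coeff (genPoly γ *ᴾ genPoly δ) k +ᴿ -ᴿ coeff (genPoly α *ᴾ genPoly β) k
      ≈⟨ coeff--ᴾ (genPoly γ *ᴾ genPoly δ) (genPoly α *ᴾ genPoly β) k ⟨
    coeff (genPoly γ *ᴾ genPoly δ -ᴾ genPoly α *ᴾ genPoly β) k ∎)) ,
  (λ k → unwrap (begin
    pairSum α β k            ≈⟨ pairSum≈∑∑ α β k ⟩
    ∑∑ (gradedTerm k α β)    ≲⟨ graded k ⟩
    ∑∑ (gradedTerm k γ δ)    ≈⟨ pairSum≈∑∑ γ δ k ⟨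
    pairSum γ δ k            ∎))
  where
  graded : ∀ k → ∑∑ (gradedTerm k α β) ≼ ∑∑ (gradedTerm k γ δ)
  graded = gradedSum-mono (wrap ∘ 0≤α) (wrap ∘ 0≤β) (wrap ∘ 0≤γ) (wrap ∘ 0≤δ)
    (λ A B → wrap (h A B))
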